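{- For every positive integer $t$ and every finite graph $G$ admitting a vertex cover of size at most $t$, the hypergraph of balls in $G$ has a proper sample compression scheme of size $t+4$.
   Context: A vertex cover of $G$ is a set $R\subseteq V(G)$ meeting every edge. A hypergraph $H$ is a pair $(V(H),E(H))$ with $V(H)$ finite and $E(H)\subseteq 2^{V(H)}$. A sample of $H$ is a pair $(X^+,X^-)$ of subsets of $V(H)$ such that some $e\in E(H)$ has $X^+\subseteq e$, $X^-\cap e=\emptyset$; $\mathcal{S}(H)$ is the set of samples. $S$ realizes $(X^+,X^-)$ if $X^+\subseteq S$, $S\cap X^-=\emptyset$. A subsample of $(X^+,X^-)$ is a sample $(Y^+,Y^-)$ with $Y^\pm\subseteq X^\pm$, of size $|Y^+\cup Y^-|$. A sample compression scheme is a pair $(\kappa,\rho)$ with $\kappa:\mathcal{S}(H)\to\mathcal{S}(H)\times\{0,1\}^*$, $\rho:\mathcal{S}(H)\times\{0,1\}^*\to 2^{V(H)}$, such that for every sample the first component of $\kappa(X^+,X^-)$ is a subsample of it and $\rho(\kappa(X^+,X^-))$ realizes it; its size is $k_1+k_2$ with $k_1$ the maximum size of the subsample and $k_2$ the maximum bitstring length output by $\kappa$; it is proper if every value of $\rho$ is a hyperedge. The hypergraph of balls in $G$ has vertex set $V(G)$ and hyperedges all $B_G(c,r)=\{v:\mathrm{dist}_G(c,v)\le r\}$ for $c\in V(G)$, $r$ an integer. -}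

module Defs where

open import Data.Bool using (Bool)
open import Data.Fin using (Fin)
open import Data.Fin.Subset using (Subset; _∈_; _⊆_; _∩_; _∪_; ∣_∣; Empty)
open import Data.Integer as ℤ using (ℤ; +_)
open import Data.List using (List; length)
open import Data.Nat using (ℕ; zero; suc; _+_; _≤_)
open import Data.Product using (Σ; ∃-syntax; _×_; proj₁; proj₂)
open import Data.Sum using (_⊎_)
open import Function.Bundles using (_⇔_)
open import Level using (0ℓ)
open import Relation.Binary using (Rel; Decidable; Symmetric; Irreflexive)
open import Relation.Binary.PropositionalEquality using (_≡_)
open import Relation.Unary using (Pred)

-- Finite simple undirected graphs, possibly empty or disconnected.
record Graph : Set₁ where
  field
    order  : ℕ
    _~_    : Rel (Fin order) 0ℓ
    _~?_   : Decidable _~_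
    sym    : Symmetric _~_
    irrefl : Irreflexive _≡_ _~_

  Vertex : Set
  Vertex = Fin order

  data Walk : Vertex → Vertex → ℕ → Set where
    nil  : ∀ {u} → Walk u u zero
    cons : ∀ {u v w k} → u ~ v → Walk v w k → Walk u w (suc k)

  -- The distance as a relation: vertices in different components are at no
  -- (i.e. infinite) distance.
  IsDist : Vertex → Vertex → ℕ → Set
  IsDist u v d = Walk u v d × (∀ {k} → Walk u v k → d ≤ k)

  Dist≤ : Vertex → Vertex → ℤ → Set
  Dist≤ u v r = ∃[ d ] (IsDist u v d × + d ℤ.≤ r)

  IsVertexCover : Subset order → Set
  IsVertexCover R = ∀ {u v} → u ~ v → u ∈ R ⊎ v ∈ R

  IsBall : Vertex → ℤ → Subset order → Set
  IsBall c r B = ∀ v → v ∈ B ⇔ Dist≤ c v r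

record Hypergraph : Set₁ where
  field
    order       : ℕ
    IsHyperedge : Pred (Subset order) 0ℓ

-- The radius may be negative, so the empty set is a hyperedge as soon as the
-- graph has a vertex.
ballHypergraph : Graph → Hypergraph
ballHypergraph G = record
  { order       = order
  ; IsHyperedge = λ B → ∃[ c ] ∃[ r ] IsBall c r B
  }
  where open Graph G

module _ (H : Hypergraph) where
  open Hypergraph H

  -- The hyperedge is irrelevant: a sample is only the pair (X⁺ , X⁻).
  -- Otherwise a compressor could pass the hyperedge on to the reconstructor
  -- inside the proof component.
  record Sample : Set where
    constructor sample
    field
      X⁺ X⁻     : Subset order
      .isSample : ∃[ e ] (IsHyperedge e × X⁺ ⊆ e × Empty (X⁻ ∩ e))

module _ {H : Hypergraph} where
  open Hypergraph H
  open Sample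

  Realizes : Subset order → Sample H → Set
  Realizes S s = X⁺ s ⊆ S × Empty (S ∩ X⁻ s)

  IsSubsample : Sample H → Sample H → Set
  IsSubsample y x = X⁺ y ⊆ X⁺ x × X⁻ y ⊆ X⁻ x

  sampleSize : Sample H → ℕ
  sampleSize y = ∣ X⁺ y ∪ X⁻ y ∣

-- k is the maximum of f, read as 0 when A is empty.
IsMax : {A : Set} → (A → ℕ) → ℕ → Set
IsMax f k = (∀ a → f a ≤ k) × (∀ m → (∀ a → f a ≤ m) → k ≤ m)

record SampleCompressionScheme (H : Hypergraph) : Set where
  open Hypergraph H
  field
    κ         : Sample H → Sample H × List Bool
    ρ         : Sample H × List Bool → Subset order
    subsample : ∀ s → IsSubsample (proj₁ (κ s)) s
    realizes  : ∀ s → Realizes (ρ (κ s)) s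

  Proper : Set
  Proper = ∀ x → IsHyperedge (ρ x)

  IsSize : ℕ → Set
  IsSize k = ∃[ k₁ ] ∃[ k₂ ]
    ( IsMax (λ s → sampleSize (proj₁ (κ s))) k₁
    × IsMax (λ s → length (proj₂ (κ s))) k₂
    × k ≡ k₁ + k₂ )

-- As usual, "of size k" means of size at most k.
HasProperSchemeOfSize : Hypergraph → ℕ → Set
HasProperSchemeOfSize H k =
  Σ (SampleCompressionScheme H) λ C →
    let open SampleCompressionScheme C in
    Proper × ∃[ m ] (IsSize m × m ≤ k)

{-# OPTIONS --safe #-}

-- Let c be a centre and k the least radius for which B(c,k) contains X⁺; this
-- ball still misses X⁻.  A vertex u ∈ X⁺ at distance exactly k from c encodes
-- the radius.  The centre is encoded by its code: itself if it lies in the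
-- vertex cover R, and its neighbourhood, a subset of R, otherwise.  Two
-- non-isolated vertices with equal codes have the same balls of radius at least 2.
-- For k = 1 and c ∈ X⁺ the centre itself is stored.  For k = 1 and c ∉ X⁺, any
-- vertex outside X⁻ with the code of c may serve as a centre, and the first one
-- is either the first vertex with this code or the successor, among the vertices
-- with this code, of a member of X⁻.
module Submission where

open import Defs
open import Data.Bool using (Bool; true; false)
open import Data.Bool.Properties using () renaming (_≟_ to _≟ᵇ_)
open import Data.Empty using (⊥-elim)
open import Data.Fin using (Fin; zero; suc; toℕ; fromℕ<) renaming (_≤_ to _≤ᶠ_; _<_ to _<ᶠ_)
open import Data.Fin.Induction using (>-wellFounded; Acc; acc)
open import Data.Fin.Properties using (_≟_; _<?_; any?; toℕ-fromℕ<; ≤∧≢⇒<)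
open import Data.Fin.Subset using (Subset; inside; outside; _∈_; _∉_; _⊆_; _∩_; _∪_; ∣_∣; Empty; ⊥; ⁅_⁆)
open import Data.Fin.Subset.Properties using (_∈?_; _⊆?_; nonempty?; anySubset?; ∉⊥; ⊥⊆; ∣⊥∣≡0; ∣⁅x⁆∣≡1;
  x∈⁅x⁆; x∈⁅y⁆⇒x≡y; ∣p∣≤n; p⊆q⇒∣p∣≤∣q∣; p⊂q⇒∣p∣<∣q∣; x∈p∩q⁺; x∈p∩q⁻; ∩-comm; ∪-identityˡ; ∪-identityʳ)
open import Data.Integer using (ℤ; +_; -[1+_]; +≤+)
open import Data.List using (List; []; _∷_; length)
open import Data.List.Properties using (∷-injectiveˡ; ∷-injectiveʳ) renaming (≡-dec to List-≡-dec)
open import Data.Nat using (ℕ; zero; suc; _+_; _≤_; _<_; z≤n; s≤s; _≤?_)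
open import Data.Nat.Properties using (≤-refl; ≤-trans; ≤-reflexive; ≤-antisym; ≤-total; ≮⇒≥;
  <⇒≱; m≤n+m; +-monoˡ-≤; +-mono-≤; +-comm; n≤1+n)
open import Data.Product using (∃; ∃-syntax; Σ-syntax; _×_; _,_; proj₁; proj₂)
open import Data.Sum using (_⊎_; inj₁; inj₂)
open import Data.Vec using (tabulate; []; _∷_; here; there)
open import Data.Vec.Properties using (lookup∘tabulate; lookup⇒[]=; []=⇒lookup)
open import Function using (_∘_)
open import Function.Bundles using (mk⇔; Equivalence)
open import Relation.Binary.PropositionalEquality using (_≡_; refl; sym; trans; cong; subst)
open import Relation.Nullary using (¬_; Dec; yes; no; does; contradiction; ¬?; recompute; _×-dec_; _⊎-dec_)
open import Relation.Nullary.Decidable using (map′; dec-true; decidable-stable)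
open import Relation.Unary using (Decidable)

-- Least witnesses and successors under a decidable predicate.

least : {P : ℕ → Set} → Decidable P → ∀ {n} → P n → ∃[ m ] (P m × (∀ k → P k → m ≤ k))
least P? {zero}  p = zero , p , λ _ _ → z≤n
least P? {suc n} p with P? zero
... | yes p₀ = zero , p₀ , λ _ _ → z≤n
... | no ¬p₀ with least (P? ∘ suc) p
...   | m , pm , min = suc m , pm , λ where
          zero    p₀ → contradiction p₀ ¬p₀
          (suc k) pk → s≤s (min k pk)

least-fin : ∀ {n} {P : Fin n → Set} → Decidable P → ∃ P → ∃[ i ] (P i × (∀ j → P j → i ≤ᶠ j))
least-fin {suc n} P? (i , p) with P? zero
least-fin {suc n} P? (i     , p) | yes p₀ = zero , p₀ , λ _ _ → z≤n
least-fin {suc n} P? (zero  , p) | no ¬p₀ = contradiction p ¬p₀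
least-fin {suc n} P? (suc i , p) | no ¬p₀ with least-fin (P? ∘ suc) (i , p)
... | l , pl , min = suc l , pl , λ where
        zero    p₀ → contradiction p₀ ¬p₀
        (suc k) pk → s≤s (min k pk)

firstOr : ∀ {n} {P : Fin n → Set} → Fin n → Decidable P → Fin n
firstOr d P? with any? P?
... | yes p = proj₁ (least-fin P? p)
... | no  _ = d

firstOr-least : ∀ {n} {P : Fin n → Set} d (P? : Decidable P) → ∃ P →
                P (firstOr d P?) × (∀ j → P j → firstOr d P? ≤ᶠ j)
firstOr-least d P? p with any? P?
... | yes q = proj₂ (least-fin P? q)
... | no ¬q = contradiction p ¬q

firstAfter : ∀ {n} {P : Fin n → Set} → Decidable P → Fin n → Fin n
firstAfter P? p = firstOr p (λ v → p <? v ×-dec P? v)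

-- Walk upwards through the elements of `P` until `Q` holds. The walk never passes `c`: by
-- minimality each successor is at most `c`, and one violating `Q` differs from `c`. The element
-- visited just before the first success is `p`.
first-or-next : ∀ {n} {P Q : Fin n → Set} (P? : Decidable P) → Decidable Q → ∀ d {c} → P c → Q c →
                Q (firstOr d P?) ⊎
                ∃[ p ] (P p × ¬ Q p × (let q = firstAfter P? p in P q × Q q))
first-or-next {P = P} {Q = Q} P? Q? d {c} pc qc = start
  where
  walk : ∀ p → Acc (λ i j → j <ᶠ i) p → P p → ¬ Q p → p <ᶠ c →
         ∃[ p ] (P p × ¬ Q p × (let q = firstAfter P? p in P q × Q q))
  walk p (acc rs) pp ¬qp p<c
    with firstAfter P? p in eq
       | firstOr-least p (λ v → p <? v ×-dec P? v) (c , p<c , pc)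
  ... | q | (p<q , pq) , q-min with Q? q
  ...   | yes qq = p , pp , ¬qp , subst (λ q → P q × Q q) (sym eq) (pq , qq)
  ...   | no ¬qq = walk q (rs p<q) pq ¬qq
                     (≤∧≢⇒< (q-min c (p<c , pc)) λ { refl → ¬qq qc })

  start : Q (firstOr d P?) ⊎
          ∃[ p ] (P p × ¬ Q p × (let q = firstAfter P? p in P q × Q q))
  start with firstOr d P? | firstOr-least d P? (c , pc)
  ... | f | pf , f-min with Q? f
  ...   | yes qf = inj₁ qf
  ...   | no ¬qf = inj₂ (walk f (>-wellFounded f) pf ¬qf
                           (≤∧≢⇒< (f-min c pc) λ { refl → ¬qf qc }))

-- Subsets, bitstrings and one-vertex subsamples.

module _ {n : ℕ} {P : Fin n → Set} (P? : Decidable P) where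

  ⟪_⟫ : Subset n
  ⟪_⟫ = tabulate (does ∘ P?)

  ∈⟪⟫⁺ : ∀ {x} → P x → x ∈ ⟪_⟫
  ∈⟪⟫⁺ {x} p = lookup⇒[]= x ⟪_⟫ (trans (lookup∘tabulate _ x) (dec-true (P? x) p))

  ∈⟪⟫⁻ : ∀ {x} → x ∈ ⟪_⟫ → P x
  ∈⟪⟫⁻ {x} x∈ = witness (P? x) (trans (sym (lookup∘tabulate _ x)) ([]=⇒lookup x∈))
    where
    witness : {A : Set} (a? : Dec A) → does a? ≡ true → A
    witness (yes a) refl = a

restrict : ∀ {n} → Subset n → Subset n → List Bool
restrict []            []      = []
restrict (inside  ∷ R) (b ∷ p) = b ∷ restrict R p
restrict (outside ∷ R) (b ∷ p) = restrict R p

length-restrict : ∀ {n} (R p : Subset n) → length (restrict R p) ≡ ∣ R ∣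
length-restrict []            []      = refl
length-restrict (inside  ∷ R) (b ∷ p) = cong suc (length-restrict R p)
length-restrict (outside ∷ R) (b ∷ p) = length-restrict R p

restrict-∈ : ∀ {n} (R p q : Subset n) → restrict R p ≡ restrict R q →
             ∀ {v} → v ∈ R → v ∈ p → v ∈ q
restrict-∈ (inside  ∷ R) (b ∷ p) (c ∷ q) eq here here with refl ← ∷-injectiveˡ eq = here
restrict-∈ (inside  ∷ R) (b ∷ p) (c ∷ q) eq (there v∈R) (there v∈p) =
  there (restrict-∈ R p q (∷-injectiveʳ eq) v∈R v∈p)
restrict-∈ (outside ∷ R) (b ∷ p) (c ∷ q) eq (there v∈R) (there v∈p) =
  there (restrict-∈ R p q eq v∈R v∈p)

data Hint (V : Set) : Set where
  pos neg : V → Hint V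
  none    : Hint V

module _ {n : ℕ} where

  hint⁺ hint⁻ : Hint (Fin n) → Subset n
  hint⁺ (pos u) = ⁅ u ⁆
  hint⁺ _       = ⊥
  hint⁻ (neg u) = ⁅ u ⁆
  hint⁻ _       = ⊥

  -- Total, because the reconstructor must answer on every sample; a pair that encodes no hint is
  -- read as an arbitrary one.
  readHint : Subset n → Subset n → Hint (Fin n)
  readHint p q with nonempty? p | nonempty? q
  ... | yes (u , _) | _           = pos u
  ... | no _        | yes (u , _) = neg u
  ... | no _        | no _        = none

  readHint-hint : ∀ h → readHint (hint⁺ h) (hint⁻ h) ≡ h
  readHint-hint (pos u) with nonempty? ⁅ u ⁆
  ... | yes (v , v∈) = cong pos (x∈⁅y⁆⇒x≡y u v∈)
  ... | no ¬ne       = contradiction (u , x∈⁅x⁆ u) ¬ne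
  readHint-hint (neg u) with nonempty? {n} ⊥ | nonempty? ⁅ u ⁆
  ... | yes (v , v∈) | _            = contradiction v∈ ∉⊥
  ... | no _         | yes (v , v∈) = cong neg (x∈⁅y⁆⇒x≡y u v∈)
  ... | no _         | no ¬ne       = contradiction (u , x∈⁅x⁆ u) ¬ne
  readHint-hint none with nonempty? {n} ⊥
  ... | yes (v , v∈) = contradiction v∈ ∉⊥
  ... | no _         = refl

  ∣hint∣≤1 : ∀ h → ∣ hint⁺ h ∪ hint⁻ h ∣ ≤ 1
  ∣hint∣≤1 (pos u) = ≤-reflexive (trans (cong ∣_∣ (∪-identityʳ ⁅ u ⁆)) (∣⁅x⁆∣≡1 u))
  ∣hint∣≤1 (neg u) = ≤-reflexive (trans (cong ∣_∣ (∪-identityˡ ⁅ u ⁆)) (∣⁅x⁆∣≡1 u))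
  ∣hint∣≤1 none    = subst (_≤ 1) (sym (trans (cong ∣_∣ (∪-identityˡ {n} ⊥)) (∣⊥∣≡0 n))) z≤n

  ⁅⁆-⊆ : ∀ {u} {p : Subset n} → u ∈ p → ⁅ u ⁆ ⊆ p
  ⁅⁆-⊆ {u} {p} u∈p x∈ = subst (_∈ p) (sym (x∈⁅y⁆⇒x≡y u x∈)) u∈p

  Fits : Subset n → Subset n → Subset n → Set
  Fits X⁺ X⁻ S = X⁺ ⊆ S × Empty (S ∩ X⁻)

  fits? : ∀ X⁺ X⁻ → Decidable (Fits X⁺ X⁻)
  fits? X⁺ X⁻ S = X⁺ ⊆? S ×-dec ¬? (nonempty? (S ∩ X⁻))

  fits-resp : ∀ {X⁺ X⁻ S T} → S ⊆ T → T ⊆ S → Fits X⁺ X⁻ S → Fits X⁺ X⁻ T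
  fits-resp {X⁺} {X⁻} {S} {T} S⊆T T⊆S (X⁺⊆S , S∩X⁻) =
    S⊆T ∘ X⁺⊆S , λ (x , x∈) → let x∈T , x∈X⁻ = x∈p∩q⁻ T X⁻ x∈ in S∩X⁻ (x , x∈p∩q⁺ (T⊆S x∈T , x∈X⁻))

-- Decidable balls and a bound on the relevant radii.

module Balls (G : Graph) where
  open Graph G hiding (sym)
  private n = order

  -- Bounded reachability, by recursion on the bound, so that finite search decides it without
  -- computing distances.
  Within : ℕ → Vertex → Vertex → Set
  Within zero    c v = c ≡ v
  Within (suc k) c v = c ≡ v ⊎ ∃[ w ] (c ~ w × Within k w v)

  within? : ∀ k c v → Dec (Within k c v)
  within? zero    c v = c ≟ v
  within? (suc k) c v = c ≟ v ⊎-dec any? (λ w → c ~? w ×-dec within? k w v)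

  within-refl : ∀ k {c} → Within k c c
  within-refl zero    = refl
  within-refl (suc k) = inj₁ refl

  within-mono : ∀ {j k} → j ≤ k → ∀ {c v} → Within j c v → Within k c v
  within-mono {k = k} z≤n refl = within-refl k
  within-mono (s≤s j≤k) (inj₁ c≡v)             = inj₁ c≡v
  within-mono (s≤s j≤k) (inj₂ (w , c~w , w→v)) = inj₂ (w , c~w , within-mono j≤k w→v)

  within⇒walk : ∀ k {c v} → Within k c v → ∃[ j ] (j ≤ k × Walk c v j)
  within⇒walk zero    refl        = zero , z≤n , nil
  within⇒walk (suc k) (inj₁ refl) = zero , z≤n , nil
  within⇒walk (suc k) (inj₂ (w , c~w , w→v)) =
    let j , j≤k , p = within⇒walk k w→v in suc j , s≤s j≤k , cons c~w p

  walk⇒within : ∀ {c v k} → Walk c v k → Within k c v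
  walk⇒within nil          = refl
  walk⇒within (cons c~w p) = inj₂ (_ , c~w , walk⇒within p)

  within⇒dist≤ : ∀ {k c v} → Within k c v → Dist≤ c v (+ k)
  within⇒dist≤ {k} {c} {v} c→v =
    let d , p , d-min = least (λ j → within? j c v) c→v
        j , j≤d , q   = within⇒walk d p
        j≡d           = ≤-antisym j≤d (d-min j (walk⇒within q))
    in d , (subst (Walk c v) j≡d q , λ q′ → d-min _ (walk⇒within q′)) , +≤+ (d-min k c→v)

  dist≤⇒within : ∀ {k c v} → Dist≤ c v (+ k) → Within k c v
  dist≤⇒within (d , (p , _) , +≤+ d≤k) = within-mono d≤k (walk⇒within p)

  private
    -- The target is fixed and the source varies because `Within` peels off the first edge; hence
    -- one stable stage absorbs all later ones, as in `collapse`.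
    basin : Vertex → ℕ → Subset n
    basin v k = ⟪ (λ u → within? k u v) ⟫

    -- Every stage that is not stable gains a vertex. At `k = n` the second alternative is
    -- impossible, which yields `within-order`.
    grows : ∀ v k → (∃[ j ] (j ≤ k × basin v (suc j) ⊆ basin v j)) ⊎ k < ∣ basin v k ∣
    grows v zero = inj₂ (subst (_≤ ∣ basin v zero ∣) (∣⁅x⁆∣≡1 v)
      (p⊆q⇒∣p∣≤∣q∣ (⁅⁆-⊆ (∈⟪⟫⁺ (λ u → within? zero u v) refl))))
    grows v (suc k) with grows v k
    ... | inj₁ (j , j≤k , stable) = inj₁ (j , ≤-trans j≤k (n≤1+n k) , stable)
    ... | inj₂ k<∣b∣ with basin v (suc k) ⊆? basin v k
    ...   | yes stable = inj₁ (k , n≤1+n k , stable)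
    ...   | no ¬stable = inj₂ (≤-trans (s≤s k<∣b∣) (p⊂q⇒∣p∣<∣q∣ (⊆suc , strict)))
      where
      ⊆suc : basin v k ⊆ basin v (suc k)
      ⊆suc = ∈⟪⟫⁺ (λ u → within? (suc k) u v) ∘ within-mono (n≤1+n k) ∘ ∈⟪⟫⁻ (λ u → within? k u v)

      strict : ∃[ x ] (x ∈ basin v (suc k) × x ∉ basin v k)
      strict with any? (λ x → x ∈? basin v (suc k) ×-dec ¬? (x ∈? basin v k))
      ... | yes p = p
      ... | no ¬p = ⊥-elim (¬stable λ {x} x∈ →
                      decidable-stable (x ∈? basin v k) λ x∉ → ¬p (x , x∈ , x∉))

    collapse : ∀ {j v} → (∀ {u} → Within (suc j) u v → Within j u v) →
               ∀ k {u} → Within k u v → Within j u v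
    collapse {j} stable zero    refl        = within-refl j
    collapse {j} stable (suc k) (inj₁ refl) = within-refl j
    collapse     stable (suc k) (inj₂ (w , u~w , w→v)) =
      stable (inj₂ (w , u~w , collapse stable k w→v))

  within-order : ∀ k {c v} → Within k c v → Within n c v
  within-order k {c} {v} c→v with grows v n
  ... | inj₂ n<∣b∣ = contradiction (∣p∣≤n (basin v n)) (<⇒≱ n<∣b∣)
  ... | inj₁ (j , j≤n , stable) = within-mono j≤n
    (collapse (∈⟪⟫⁻ (λ u → within? j u v) ∘ stable ∘ ∈⟪⟫⁺ (λ u → within? (suc j) u v)) k c→v)

  ball : Vertex → ℤ → Subset n
  ball c (+ k)    = ⟪ within? k c ⟫
  ball c -[1+ _ ] = ⊥

  ∈ball⁺ : ∀ k {c v} → Within k c v → v ∈ ball c (+ k)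
  ∈ball⁺ k {c} = ∈⟪⟫⁺ (within? k c)

  ∈ball⁻ : ∀ k {c v} → v ∈ ball c (+ k) → Within k c v
  ∈ball⁻ k {c} = ∈⟪⟫⁻ (within? k c)

  isBall-ball : ∀ c r → IsBall c r (ball c r)
  isBall-ball c (+ k)    v = mk⇔ (within⇒dist≤ ∘ ∈ball⁻ k) (∈ball⁺ k ∘ dist≤⇒within)
  isBall-ball c -[1+ _ ] v = mk⇔ (λ v∈ → contradiction v∈ ∉⊥) λ { (_ , _ , ()) }

  SomeBallFits : Subset n → Subset n → Set
  SomeBallFits X⁺ X⁻ = ∃[ c ] ∃[ r ] Fits X⁺ X⁻ (ball c r)

  -- Radii up to the order suffice, so the search is finite; this is what makes the
  -- irrelevant hyperedge of a sample recoverable.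
  someBallFits? : ∀ X⁺ X⁻ → Dec (SomeBallFits X⁺ X⁻)
  someBallFits? X⁺ X⁻ = map′ to from
    (any? λ c → fits? X⁺ X⁻ ⊥ ⊎-dec any? (λ (k : Fin (suc n)) → fits? X⁺ X⁻ (ball c (+ toℕ k))))
    where
    Bounded : Set
    Bounded = ∃[ c ] (Fits X⁺ X⁻ ⊥ ⊎ Σ[ k ∈ Fin (suc n) ] Fits X⁺ X⁻ (ball c (+ toℕ k)))

    to : Bounded → SomeBallFits X⁺ X⁻
    to (c , inj₁ fits)       = c , -[1+ 0 ] , fits
    to (c , inj₂ (k , fits)) = c , + toℕ k , fits

    below : ∀ {c k} → k ≤ n → Fits X⁺ X⁻ (ball c (+ k)) → Bounded
    below {c} k≤n fits = c , inj₂ (fromℕ< (s≤s k≤n) ,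
      subst (λ j → Fits X⁺ X⁻ (ball c (+ j))) (sym (toℕ-fromℕ< (s≤s k≤n))) fits)

    from : SomeBallFits X⁺ X⁻ → Bounded
    from (c , -[1+ _ ] , fits) = c , inj₁ fits
    from (c , + k , fits) with ≤-total k n
    ... | inj₁ k≤n = below k≤n fits
    ... | inj₂ n≤k = below ≤-refl (fits-resp (∈ball⁺ n ∘ within-order k ∘ ∈ball⁻ k)
                                             (∈ball⁺ k ∘ within-mono n≤k ∘ ∈ball⁻ n) fits)

-- Codes of centres, and compression of a fitting ball.

module Compression (G : Graph) (R : Subset (Graph.order G)) (cover : Graph.IsVertexCover G R) where
  open Graph G hiding (sym)
  open Balls G
  private n = order

  _≟ˡ_ : (a b : List Bool) → Dec (a ≡ b)
  _≟ˡ_ = List-≡-dec _≟ᵇ_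

  neighbours : Vertex → Subset n
  neighbours c = ⟪ c ~?_ ⟫

  -- The leading bit separates cover vertices from the others. Restricting to `R` loses nothing: the
  -- singleton, respectively the neighbourhood, lies in `R`.
  code : Vertex → List Bool
  code c with c ∈? R
  ... | yes _ = true  ∷ restrict R ⁅ c ⁆
  ... | no  _ = false ∷ restrict R (neighbours c)

  length-code : ∀ c → length (code c) ≡ suc ∣ R ∣
  length-code c with c ∈? R
  ... | yes _ = cong suc (length-restrict R ⁅ c ⁆)
  ... | no  _ = cong suc (length-restrict R (neighbours c))

  -- In the cover, equal codes force equal vertices. Outside it, `cover` puts `w` in `R`, where the
  -- two neighbourhoods agree.
  code-~ : ∀ {c c′} → code c ≡ code c′ → ∀ {w} → c ~ w → c′ ~ w
  code-~ {c} {c′} eq {w} c~w with c ∈? R | c′ ∈? R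
  ... | yes c∈R | yes _ = subst (_~ w) (x∈⁅y⁆⇒x≡y c′
    (restrict-∈ R ⁅ c ⁆ ⁅ c′ ⁆ (∷-injectiveʳ eq) c∈R (x∈⁅x⁆ c))) c~w
  ... | yes _ | no _ with () ← ∷-injectiveˡ eq
  ... | no _ | yes _ with () ← ∷-injectiveˡ eq
  ... | no c∉R | no _ with cover c~w
  ...   | inj₁ c∈R = contradiction c∈R c∉R
  ...   | inj₂ w∈R = ∈⟪⟫⁻ (c′ ~?_) (restrict-∈ R (neighbours c) (neighbours c′)
                       (∷-injectiveʳ eq) w∈R (∈⟪⟫⁺ (c ~?_) c~w))

  -- A nontrivial walk from `c` can start at `c′` instead, by the same first step. The vertex `c`
  -- itself is reached from `c′` through the common neighbour `x`, which costs two steps.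
  code-within : ∀ {c c′ x} → code c ≡ code c′ → c ~ x →
                ∀ j {v} → Within (2 + j) c v → Within (2 + j) c′ v
  code-within eq c~x j (inj₁ refl) =
    inj₂ (_ , code-~ eq c~x , inj₂ (_ , Graph.sym G c~x , within-refl j))
  code-within eq c~x j (inj₂ (w , c~w , w→v)) = inj₂ (w , code-~ eq c~w , w→v)

  hasCode? : ∀ b → Decidable (λ v → code v ≡ b)
  hasCode? b v = code v ≟ˡ b

  next : Vertex → Vertex
  next p = firstAfter (hasCode? (code p)) p

  -- The least j with u ∈ B(c, 2 + j); junk if u is not reachable from c.
  reach : Vertex → Vertex → ℕ
  reach c u with within? (2 + n) c u
  ... | yes c→u = proj₁ (least (λ j → within? (2 + j) c u) c→u)
  ... | no  _   = zero

  reach-least : ∀ {c u k} → Within (2 + k) c u →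
                Within (2 + reach c u) c u × (∀ j → Within (2 + j) c u → reach c u ≤ j)
  reach-least {c} {u} {k} c→u with within? (2 + n) c u
  ... | yes c→u′ = proj₂ (least (λ j → within? (2 + j) c u) c→u′)
  -- By `within-order`, a reachable vertex is already found at the search bound `2 + n`.
  ... | no ¬c→u  = contradiction (within-mono (m≤n+m n 2) (within-order (2 + k) c→u)) ¬c→u

  -- The hint and the first bit select the format. After `none`, the first bit only tells a code
  -- from the empty string, which stands for the empty ball. The default `d` keeps the decoder
  -- total, so that every output is a ball.
  decode : Vertex → Hint Vertex → List Bool → Vertex × ℤ
  decode d (pos u) []          = u , + 0
  decode d (pos u) (true ∷ _)  = u , + 1
  decode d (pos u) (false ∷ b) = let c = firstOr d (hasCode? b) in c , + (2 + reach c u)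
  decode d (neg u) _           = next u , + 1
  decode d none    []          = d , -[1+ 0 ]
  decode d none    (_ ∷ b)     = firstOr d (hasCode? b) , + 1

  decodedBall : Vertex → Hint Vertex → List Bool → Subset n
  decodedBall d h b = let c , r = decode d h b in ball c r

  record Compressed (d : Vertex) (X⁺ X⁻ : Subset n) : Set where
    constructor compressed
    field
      hint        : Hint Vertex
      bits        : List Bool
      hint⊆       : hint⁺ hint ⊆ X⁺ × hint⁻ hint ⊆ X⁻
      fits        : Fits X⁺ X⁻ (decodedBall d hint bits)
      -- One bit for the format and `1 + ∣ R ∣` for the code.
      bits-length : length bits ≤ 2 + ∣ R ∣

  module _ (d : Vertex) {X⁺ X⁻ : Subset n} where

    -- As `c` is not in `X⁺`, all of `X⁺` consists of neighbours of `c`. Unit balls around vertices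
    -- with the same code differ only in their centres, so any such centre outside `X⁻` fits
    -- (`unit`); `c` itself is one, so `first-or-next` applies.
    compress-near : ∀ {c} → Fits X⁺ X⁻ (ball c (+ 1)) → c ∉ X⁺ → Compressed d X⁺ X⁻
    compress-near {c} (X⁺⊆ , ∩X⁻) c∉X⁺ = by-order (code c) refl
      where
      unit : ∀ {v} → code c ≡ code v → v ∉ X⁻ → Fits X⁺ X⁻ (ball v (+ 1))
      unit {v} eq v∉X⁻ = ⊆-unit , unit-∩
        where
        ⊆-unit : X⁺ ⊆ ball v (+ 1)
        ⊆-unit x∈X⁺ with ∈ball⁻ 1 (X⁺⊆ x∈X⁺)
        ... | inj₁ refl              = contradiction x∈X⁺ c∉X⁺
        ... | inj₂ (w , c~w , refl) = ∈ball⁺ 1 (inj₂ (w , code-~ eq c~w , refl))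

        unit-∩ : Empty (ball v (+ 1) ∩ X⁻)
        unit-∩ (x , x∈) with x∈p∩q⁻ (ball v (+ 1)) X⁻ x∈
        ... | x∈ball , x∈X⁻ with ∈ball⁻ 1 x∈ball
        ...   | inj₁ refl             = v∉X⁻ x∈X⁻
        ...   | inj₂ (w , v~w , refl) =
          ∩X⁻ (w , x∈p∩q⁺ (∈ball⁺ 1 (inj₂ (w , code-~ (sym eq) v~w , refl)) , x∈X⁻))

      c∉X⁻ : c ∉ X⁻
      c∉X⁻ c∈X⁻ = ∩X⁻ (c , x∈p∩q⁺ (∈ball⁺ 1 (within-refl 1) , c∈X⁻))

      by-order : ∀ b → code c ≡ b → Compressed d X⁺ X⁻
      by-order b eq with first-or-next (hasCode? b) (λ v → ¬? (v ∈? X⁻)) d eq c∉X⁻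
      ... | inj₁ f∉X⁻ = compressed none (false ∷ b) (⊥⊆ , ⊥⊆)
        (unit (trans eq (sym (proj₁ (firstOr-least d (hasCode? b) (c , eq))))) f∉X⁻)
        (s≤s (≤-reflexive (trans (cong length (sym eq)) (length-code c))))
      -- No bits are sent: the code is that of `p`.
      ... | inj₂ (p , refl , ¬p∉X⁻ , next-code , next∉X⁻) = compressed (neg p) []
        (⊥⊆ , ⁅⁆-⊆ (decidable-stable (p ∈? X⁻) ¬p∉X⁻))
        (unit (trans eq (sym next-code)) next∉X⁻) z≤n

    compress-far : ∀ {c u k} → Fits X⁺ X⁻ (ball c (+ (2 + k))) → u ∈ X⁺ → ¬ Within (1 + k) c u →
                   Compressed d X⁺ X⁻
    compress-far {c} {u} {k} fits@(X⁺⊆ , _) u∈X⁺ ¬c→u with ∈ball⁻ (2 + k) (X⁺⊆ u∈X⁺)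
    ... | inj₁ refl = contradiction (within-refl (1 + k)) ¬c→u
    -- The first step towards `u` gives the neighbour `x` that `code-within` requires.
    ... | c→u@(inj₂ (x , c~x , _)) = compressed (pos u) (false ∷ code c) (⁅⁆-⊆ u∈X⁺ , ⊥⊆)
      (subst (λ j → Fits X⁺ X⁻ (ball c′ (+ (2 + j)))) (sym reach≡k)
        (fits-resp (∈ball⁺ (2 + k) ∘ to k ∘ ∈ball⁻ (2 + k)) (∈ball⁺ (2 + k) ∘ from k ∘ ∈ball⁻ (2 + k)) fits))
      (s≤s (≤-reflexive (length-code c)))
      where
      c′ : Vertex
      c′ = firstOr d (hasCode? (code c))

      eq : code c′ ≡ code c
      eq = proj₁ (firstOr-least d (hasCode? (code c)) (c , refl))

      to : ∀ j {v} → Within (2 + j) c v → Within (2 + j) c′ v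
      to = code-within (sym eq) c~x

      from : ∀ j {v} → Within (2 + j) c′ v → Within (2 + j) c v
      from = code-within eq (code-~ (sym eq) c~x)

      -- Reachability of `u` transfers between `c` and `c′` in both directions; a smaller value at
      -- `c′` would put `u` within `1 + k` of `c`.
      reach≡k : reach c′ u ≡ k
      reach≡k with reach-least {k = k} (to k c→u)
      ... | c′→u , min = ≤-antisym (min k (to k c→u)) (≮⇒≥ λ r<k →
                           ¬c→u (within-mono (s≤s r<k) (from (reach c′ u) c′→u)))

    compress : SomeBallFits X⁺ X⁻ → Compressed d X⁺ X⁻
    compress (c , -[1+ _ ] , X⁺⊆⊥ , _) = compressed none [] (⊥⊆ , ⊥⊆)
      (X⁺⊆⊥ , λ (x , x∈) → ∉⊥ (proj₁ (x∈p∩q⁻ ⊥ X⁻ x∈))) z≤n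
    compress (c , + k , X⁺⊆ , ∩X⁻) with least (λ j → X⁺ ⊆? ball c (+ j)) {k} X⁺⊆
    ... | m , X⁺⊆m , m-min = by-radius m X⁺⊆m m-min
        (X⁺⊆m , λ (x , x∈) → let x∈ball , x∈X⁻ = x∈p∩q⁻ (ball c (+ m)) X⁻ x∈ in
          ∩X⁻ (x , x∈p∩q⁺ (∈ball⁺ k (within-mono (m-min k X⁺⊆) (∈ball⁻ m {c} x∈ball)) , x∈X⁻)))
      where
      by-radius : ∀ m → X⁺ ⊆ ball c (+ m) → (∀ j → X⁺ ⊆ ball c (+ j) → m ≤ j) →
                  Fits X⁺ X⁻ (ball c (+ m)) → Compressed d X⁺ X⁻
      by-radius zero X⁺⊆c _ fits with c ∈? X⁺
      ... | yes c∈X⁺ = compressed (pos c) [] (⁅⁆-⊆ c∈X⁺ , ⊥⊆) fits z≤n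
      -- Here `X⁺` is contained in the singleton of `c` but avoids `c`, so it is empty and the empty
      -- ball fits.
      ... | no c∉X⁺  = compressed none [] (⊥⊆ , ⊥⊆)
        ( (λ x∈X⁺ → contradiction (subst (_∈ X⁺) (sym (∈ball⁻ 0 {c} (X⁺⊆c x∈X⁺))) x∈X⁺) c∉X⁺)
        , λ (x , x∈) → ∉⊥ (proj₁ (x∈p∩q⁻ ⊥ X⁻ x∈))) z≤n
      by-radius (suc zero) _ _ fits with c ∈? X⁺
      ... | yes c∈X⁺ = compressed (pos c) (true ∷ []) (⁅⁆-⊆ c∈X⁺ , ⊥⊆) fits (s≤s z≤n)
      ... | no c∉X⁺  = compress-near fits c∉X⁺
      by-radius (suc (suc k)) _ m-min fits with any? (λ u → u ∈? X⁺ ×-dec ¬? (within? (1 + k) c u))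
      ... | yes (u , u∈X⁺ , ¬c→u) = compress-far fits u∈X⁺ ¬c→u
      ... | no ¬far = contradiction ≤-refl (<⇒≱ (m-min (1 + k) λ {u} u∈X⁺ → ∈ball⁺ (1 + k)
        (decidable-stable (within? (1 + k) c u) λ ¬c→u → ¬far (u , u∈X⁺ , ¬c→u))))

-- Assembling the scheme and measuring its size.

private
  -- The argument only certifies that a vertex exists. Since it is irrelevant, compressor and
  -- reconstructor obtain the same default from different proofs.
  some : ∀ {n} → .(Fin n) → Fin n
  some {suc n} _ = zero

module Scheme (G : Graph) (R : Subset (Graph.order G)) (cover : Graph.IsVertexCover G R) where
  open Graph G using (order)
  open Balls G
  open Compression G R cover

  H : Hypergraph
  H = ballHypergraph G

  IsSample : Subset order → Subset order → Set
  IsSample X⁺ X⁻ = ∃[ e ] (Hypergraph.IsHyperedge H e × X⁺ ⊆ e × Empty (X⁻ ∩ e))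

  isSample⁺ : ∀ {X⁺ X⁻} → SomeBallFits X⁺ X⁻ → IsSample X⁺ X⁻
  isSample⁺ {X⁺} {X⁻} (c , r , X⁺⊆ , ∩X⁻) =
    ball c r , (c , r , isBall-ball c r) , X⁺⊆ , subst Empty (∩-comm (ball c r) X⁻) ∩X⁻

  isSample⁻ : ∀ {X⁺ X⁻} → IsSample X⁺ X⁻ → SomeBallFits X⁺ X⁻
  isSample⁻ {X⁺} {X⁻} (e , (c , r , isBall) , X⁺⊆e , X⁻∩e) =
    c , r , fits-resp
      (λ {v} → Equivalence.from (isBall-ball c r v) ∘ Equivalence.to (isBall v))
      (λ {v} → Equivalence.from (isBall v) ∘ Equivalence.to (isBall-ball c r v))
      (X⁺⊆e , subst Empty (∩-comm X⁻ e) X⁻∩e)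

  isSample? : ∀ X⁺ X⁻ → Dec (IsSample X⁺ X⁻)
  isSample? X⁺ X⁻ = map′ isSample⁺ isSample⁻ (someBallFits? X⁺ X⁻)

  -- The irrelevant hyperedge cannot be inspected; `recompute` finds a fitting ball from `X⁺` and
  -- `X⁻` alone.
  compressSample : ∀ ((sample X⁺ X⁻ p) : Sample H) → Compressed (some (proj₁ (isSample⁻ p))) X⁺ X⁻
  compressSample (sample X⁺ X⁻ p) =
    compress (some (proj₁ (isSample⁻ p))) (isSample⁻ (recompute (isSample? X⁺ X⁻) p))

  all≤? : (f : Sample H → ℕ) → Decidable (λ k → ∀ s → f s ≤ k)
  all≤? f k = map′ {A = ¬ (∃[ X⁺ ] ∃[ X⁻ ] Exceeds X⁺ X⁻)}
    (λ ¬∃ (sample X⁺ X⁻ p) → let p′ = recompute (isSample? X⁺ X⁻) p in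
      decidable-stable (f (sample X⁺ X⁻ p) ≤? k) λ f≰k → ¬∃ (X⁺ , X⁻ , p′ , f≰k))
    (λ ∀≤ (X⁺ , X⁻ , p , f≰k) → f≰k (∀≤ (sample X⁺ X⁻ p)))
    (¬? (anySubset? λ X⁺ → anySubset? λ X⁻ → exceeds? X⁺ X⁻))
    where
    Exceeds : Subset order → Subset order → Set
    Exceeds X⁺ X⁻ = Σ[ p ∈ IsSample X⁺ X⁻ ] ¬ f (sample X⁺ X⁻ p) ≤ k

    exceeds? : ∀ X⁺ X⁻ → Dec (Exceeds X⁺ X⁻)
    exceeds? X⁺ X⁻ with isSample? X⁺ X⁻
    ... | no ¬p = no (¬p ∘ proj₁)
    -- Testing one `p` suffices: samples with the same two sets are equal by irrelevance.
    ... | yes p = map′ (p ,_) proj₂ (¬? (f (sample X⁺ X⁻ p) ≤? k))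

  -- `IsSize` asks for exact maxima, not mere bounds. The maximum is the least upper bound, found by
  -- search because `all≤?` decides upper bounds.
  max : (f : Sample H → ℕ) → ∀ {N} → (∀ s → f s ≤ N) → ∃[ k ] (IsMax f k × k ≤ N)
  max f {N} f≤N = let k , f≤k , k-min = least (all≤? f) f≤N in k , (f≤k , k-min) , k-min N f≤N

  scheme : SampleCompressionScheme H
  scheme = record
    { κ         = κ
    ; ρ         = ρ
    ; subsample = λ s → Compressed.hint⊆ (compressSample s)
    ; realizes  = realizes
    }
    where
    κ : Sample H → Sample H × List Bool
    κ s@(sample X⁺ X⁻ p) = sample (hint⁺ hint) (hint⁻ hint) (subsample-isSample p) , bits
      where
      open Compressed (compressSample s)

      subsample-isSample : IsSample X⁺ X⁻ → IsSample (hint⁺ hint) (hint⁻ hint)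
      subsample-isSample (e , he , X⁺⊆e , X⁻∩e) =
        e , he , X⁺⊆e ∘ proj₁ hint⊆ , λ (x , x∈) → let x∈⁻ , x∈e = x∈p∩q⁻ (hint⁻ hint) e x∈ in
          X⁻∩e (x , x∈p∩q⁺ (proj₂ hint⊆ x∈⁻ , x∈e))

    ρ : Sample H × List Bool → Subset order
    ρ (sample Y⁺ Y⁻ p , b) = decodedBall (some (proj₁ (isSample⁻ p))) (readHint Y⁺ Y⁻) b

    realizes : ∀ s → Realizes (ρ (κ s)) s
    realizes s@(sample X⁺ X⁻ p) =
      subst (λ h → Fits X⁺ X⁻ (decodedBall (some (proj₁ (isSample⁻ p))) h bits))
        (sym (readHint-hint hint)) fits
      where open Compressed (compressSample s)

  open SampleCompressionScheme scheme

  proper : Proper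
  proper (sample Y⁺ Y⁻ p , b) =
    let c , r = decode (some (proj₁ (isSample⁻ p))) (readHint Y⁺ Y⁻) b in c , r , isBall-ball c r

  size : ∃[ m ] (IsSize m × m ≤ ∣ R ∣ + 4)
  size =
    let k₁ , max₁ , k₁≤ = max (λ s → sampleSize (proj₁ (κ s))) {1}
                            (λ s → ∣hint∣≤1 (Compressed.hint (compressSample s)))
        k₂ , max₂ , k₂≤ = max (λ s → length (proj₂ (κ s))) {2 + ∣ R ∣}
                            (λ s → Compressed.bits-length (compressSample s))
    in k₁ + k₂ , (k₁ , k₂ , max₁ , max₂ , refl) ,
       -- At most one vertex and `2 + ∣ R ∣` bits make `3 + ∣ R ∣`.
       ≤-trans (+-mono-≤ k₁≤ k₂≤)
         (subst (3 + ∣ R ∣ ≤_) (+-comm 4 ∣ R ∣) (n≤1+n (3 + ∣ R ∣)))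

theorem1p3 : (t : ℕ) → 1 ≤ t → (G : Graph) (R : Subset (Graph.order G)) →
    Graph.IsVertexCover G R → ∣ R ∣ ≤ t →
    HasProperSchemeOfSize (ballHypergraph G) (t + 4)
theorem1p3 t _ G R cover ∣R∣≤t =
  let m , isSize , m≤ = size in
  scheme , proper , m , isSize , ≤-trans m≤ (+-monoˡ-≤ 4 ∣R∣≤t)
  where open Scheme G R cover
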